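{- Let $n\ge1$ and let $\mathcal{I}$ be an interval hypergraph on $[n]$ containing all singletons. The map $\pi\mapsto \mathrm{Or}_\pi$ from the weak order on permutations of $[n]$ to $P_{\mathcal{I}}$ is a meet (resp. join) semilattice morphism if and only if $\mathcal{I}$ is closed under initial (resp. final) subintervals, i.e. $[i,k]\in\mathcal{I}$ implies $[i,j]\in\mathcal{I}$ (resp. $[j,k]\in\mathcal{I}$) for all $1\le i<j<k\le n$.
   Context: An interval hypergraph $\mathcal{I}$ on $[n]$ is a collection of intervals $[i,j]=\{i,\dots,j\}$ of $[n]$, by convention containing all singletons. An orientation is a map $O:\mathcal{I}\to[n]$ with $O(I)\in I$; it is acyclic if there are no $H_1,\dots,H_k\in\mathcal{I}$, $k\ge2$, with $O(H_{i+1})\in H_i\setminus\{O(H_i)\}$ for $i\in[k-1]$ and $O(H_1)\in H_k\setminus\{O(H_k)\}$. Orientations $O\ne O'$ are related by an increasing flip (from $O$ to $O'$) if there exist $1\le i<j\le n$ such that for all $H$: if $O(H)\ne O'(H)$ then $O(H)=i$, $O'(H)=j$; and if $\{i,j\}\subseteq H$ then $O(H)=i\iff O'(H)=j$. $P_{\mathcal{I}}$ is the transitive closure of the increasing flip relation on acyclic orientations. For a permutation $\pi$ of $[n]$ (in one-line notation), $\mathrm{Or}_\pi$ is the acyclic orientation with $\mathrm{Or}_\pi(I)=\pi(\min\{j:\pi(j)\in I\})$; this map is a surjective poset morphism from the weak order to $P_{\mathcal{I}}$. A map $\phi$ between meet semilattices is a meet semilattice morphism if $\phi(a\wedge b)=\phi(a)\wedge\phi(b)$;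 equivalently, each fiber of $\phi$ is order convex and has a unique minimal element, and the map sending $a$ to the minimal element of its fiber is order preserving. Join semilattice morphisms are defined dually. -}

module Defs where

open import Algebra.Core using (Op₂)
open import Data.Fin.Base using (Fin; zero; suc; toℕ; fromℕ; inject₁; _<_; _≤_)
open import Data.Fin.Permutation using (Permutation′; _⟨$⟩ʳ_; _⟨$⟩ˡ_; inverseˡ; inverseʳ)
  renaming (_≈_ to _≈ₚ_)
open import Data.Fin.Properties
  using (_≤?_; ≤-refl; ≤-trans; ≤-reflexive; ≤-antisym; <-irrefl; <-trans; <-cmp;
         toℕ-injective; toℕ-inject₁; _≟_)
open import Data.Nat.Base as ℕ using (ℕ)
import Data.Nat.Properties as ℕ
open import Data.Product.Base using (∃; _×_; _,_; proj₁; proj₂)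
open import Data.Sum.Base using (_⊎_; inj₁; inj₂)
open import Function.Base using (_∘_)
open import Function.Bundles using (_⇔_)
open import Function.Definitions using (Congruent)
open import Level using (Level; 0ℓ; _⊔_)
open import Relation.Binary.Bundles using (Poset)
open import Relation.Binary.Construct.Closure.Transitive as Trans using (TransClosure; [_]; _∷_)
open import Relation.Binary.Core using (Rel)
open import Relation.Binary.Definitions using (tri<; tri≈; tri>)
open import Relation.Binary.Lattice.Definitions using (Infimum; Supremum)
open import Relation.Binary.PropositionalEquality
  using (_≡_; _≢_; refl; sym; trans; cong; subst; subst₂)
open import Relation.Nullary using (¬_; Dec; yes; no; contradiction)
open import Relation.Nullary.Decidable using (_×-dec_; recompute)
open import Relation.Unary using (Pred; Decidable)

private
  variable
    n : ℕ

-- That both posets have all binary meets (joins) is part of being a morphism.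

module _ {c₁ ℓ₁ r₁ c₂ ℓ₂ r₂ : Level}
         (P : Poset c₁ ℓ₁ r₁) (Q : Poset c₂ ℓ₂ r₂) where
  private
    module P = Poset P
    module Q = Poset Q

  record IsMeetSemilatticeMorphism (f : P.Carrier → Q.Carrier)
         : Set (c₁ ⊔ ℓ₁ ⊔ r₁ ⊔ c₂ ⊔ ℓ₂ ⊔ r₂) where
    field
      _∧₁_     : Op₂ P.Carrier
      infimum₁ : Infimum P._≤_ _∧₁_
      _∧₂_     : Op₂ Q.Carrier
      infimum₂ : Infimum Q._≤_ _∧₂_
      f-cong   : Congruent P._≈_ Q._≈_ f
      ∧-homo   : ∀ a b → f (a ∧₁ b) Q.≈ (f a ∧₂ f b)

  record IsJoinSemilatticeMorphism (f : P.Carrier → Q.Carrier)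
         : Set (c₁ ⊔ ℓ₁ ⊔ r₁ ⊔ c₂ ⊔ ℓ₂ ⊔ r₂) where
    field
      _∨₁_      : Op₂ P.Carrier
      supremum₁ : Supremum P._≤_ _∨₁_
      _∨₂_      : Op₂ Q.Carrier
      supremum₂ : Supremum Q._≤_ _∨₂_
      f-cong    : Congruent P._≈_ Q._≈_ f
      ∨-homo    : ∀ a b → f (a ∨₁ b) Q.≈ (f a ∨₂ f b)

-- The proof fields of Interval and Hyperedge are irrelevant, so that an
-- interval is determined by its endpoints and an orientation cannot
-- depend on proofs of membership.

record Interval (n : ℕ) : Set where
  constructor interval
  field
    lo     : Fin n
    hi     : Fin n
    .lo≤hi : lo ≤ hi

open Interval public using (lo; hi)

infix 4 _∈_ _∈?_

_∈_ : Fin n → Interval n → Set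
a ∈ H = lo H ≤ a × a ≤ hi H

_∈?_ : (a : Fin n) (H : Interval n) → Dec (a ∈ H)
a ∈? H = (lo H ≤? a) ×-dec (a ≤? hi H)

lo∈ : (H : Interval n) → lo H ∈ H
lo∈ (interval l h l≤h) = ≤-refl , recompute (l ≤? h) l≤h

record IntervalHypergraph (n : ℕ) : Set₁ where
  field
    Member     : Pred (Interval n) 0ℓ
    member?    : Decidable Member
    singletons : ∀ i → Member (interval i i ≤-refl)

open IntervalHypergraph public

ClosedUnderInitial : IntervalHypergraph n → Set
ClosedUnderInitial {n} I =
  ∀ {i j k : Fin n} (i<j : i < j) (j<k : j < k) →
  Member I (interval i k (ℕ.<⇒≤ (<-trans i<j j<k))) →
  Member I (interval i j (ℕ.<⇒≤ i<j))

ClosedUnderFinal : IntervalHypergraph n → Set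
ClosedUnderFinal {n} I =
  ∀ {i j k : Fin n} (i<j : i < j) (j<k : j < k) →
  Member I (interval i k (ℕ.<⇒≤ (<-trans i<j j<k))) →
  Member I (interval j k (ℕ.<⇒≤ j<k))

record Hyperedge {n : ℕ} (I : IntervalHypergraph n) : Set where
  constructor hyperedge
  field
    edge      : Interval n
    .isMember : Member I edge

open Hyperedge public using (edge)

record Orientation {n : ℕ} (I : IntervalHypergraph n) : Set where
  field
    head  : Hyperedge I → Fin n
    head∈ : ∀ H → head H ∈ edge H

open Orientation public

record Cycle {n : ℕ} {I : IntervalHypergraph n} (O : Orientation I) : Set where
  field
    -- The length k ≥ 2 of the cycle is 2 + m.
    m      : ℕ
    H      : Fin (2 ℕ.+ m) → Hyperedge I
    step   : ∀ (i : Fin (1 ℕ.+ m)) →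
             head O (H (suc i)) ∈ edge (H (inject₁ i)) ×
             head O (H (suc i)) ≢ head O (H (inject₁ i))
    return : head O (H zero) ∈ edge (H (fromℕ (1 ℕ.+ m))) ×
             head O (H zero) ≢ head O (H (fromℕ (1 ℕ.+ m)))

record AcyclicOrientation {n : ℕ} (I : IntervalHypergraph n) : Set where
  field
    orientation : Orientation I
    acyclic     : ¬ Cycle orientation

  open Orientation orientation public using () renaming (head to headₐ)

open AcyclicOrientation public

private
  variable
    I : IntervalHypergraph n

infix 4 _≈ₒ_ _≤ₒ_

_≈ₒ_ : Rel (AcyclicOrientation I) 0ℓ
O ≈ₒ O′ = ∀ H → headₐ O H ≡ headₐ O′ H

record IncreasingFlip {n : ℕ} {I : IntervalHypergraph n}
                      (O O′ : AcyclicOrientation I) : Set where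
  field
    distinct : ¬ (O ≈ₒ O′)
    i j      : Fin n
    i<j      : i < j
    changed  : ∀ H → headₐ O H ≢ headₐ O′ H → headₐ O H ≡ i × headₐ O′ H ≡ j
    flipped  : ∀ H → i ∈ edge H → j ∈ edge H → headₐ O H ≡ i ⇔ headₐ O′ H ≡ j

_≤ₒ_ : Rel (AcyclicOrientation I) 0ℓ
O ≤ₒ O′ = O ≈ₒ O′ ⊎ TransClosure IncreasingFlip O O′

private
  flip-respˡ : ∀ {O O′ O″ : AcyclicOrientation I} →
               O ≈ₒ O′ → IncreasingFlip O′ O″ → IncreasingFlip O O″
  flip-respˡ O≈O′ F = record
    { distinct = λ O≈O″ → distinct λ H → trans (sym (O≈O′ H)) (O≈O″ H)
    ; i = i ; j = j ; i<j = i<j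
    ; changed = λ H → subst (λ h → h ≢ _ → h ≡ i × _) (sym (O≈O′ H)) (changed H)
    ; flipped = λ H → subst (λ h → _ → _ → h ≡ i ⇔ _) (sym (O≈O′ H)) (flipped H)
    }
    where open IncreasingFlip F

  flip-respʳ : ∀ {O O′ O″ : AcyclicOrientation I} →
               IncreasingFlip O O′ → O′ ≈ₒ O″ → IncreasingFlip O O″
  flip-respʳ F O′≈O″ = record
    { distinct = λ O≈O″ → distinct λ H → trans (O≈O″ H) (sym (O′≈O″ H))
    ; i = i ; j = j ; i<j = i<j
    ; changed = λ H → subst (λ h → _ ≢ h → _ × h ≡ j) (O′≈O″ H) (changed H)
    ; flipped = λ H → subst (λ h → _ → _ → _ ⇔ h ≡ j) (O′≈O″ H) (flipped H)
    }
    where open IncreasingFlip F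

  flips-respˡ : ∀ {O O′ O″ : AcyclicOrientation I} → O ≈ₒ O′ →
                TransClosure IncreasingFlip O′ O″ → TransClosure IncreasingFlip O O″
  flips-respˡ e [ F ]    = [ flip-respˡ e F ]
  flips-respˡ e (F ∷ Fs) = flip-respˡ e F ∷ Fs

  flips-respʳ : ∀ {O O′ O″ : AcyclicOrientation I} → TransClosure IncreasingFlip O O′ →
                O′ ≈ₒ O″ → TransClosure IncreasingFlip O O″
  flips-respʳ [ F ]    e = [ flip-respʳ F e ]
  flips-respʳ (F ∷ Fs) e = F ∷ flips-respʳ Fs e

  ≤ₒ-trans : ∀ {O O′ O″ : AcyclicOrientation I} → O ≤ₒ O′ → O′ ≤ₒ O″ → O ≤ₒ O″
  ≤ₒ-trans (inj₁ e)  (inj₁ e′)  = inj₁ λ H → trans (e H) (e′ H)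
  ≤ₒ-trans (inj₁ e)  (inj₂ Fs)  = inj₂ (flips-respˡ e Fs)
  ≤ₒ-trans (inj₂ Fs) (inj₁ e)   = inj₂ (flips-respʳ Fs e)
  ≤ₒ-trans (inj₂ Fs) (inj₂ Fs′) = inj₂ (Fs Trans.++ Fs′)

  flip⇒pointwise : ∀ {O O′ : AcyclicOrientation I} → IncreasingFlip O O′ →
                   ∀ H → headₐ O H ≤ headₐ O′ H
  flip⇒pointwise {O = O} {O′} F H with headₐ O H ≟ headₐ O′ H
  ... | yes e = ≤-reflexive e
  ... | no ne = subst₂ _≤_ (sym (proj₁ c)) (sym (proj₂ c)) (ℕ.<⇒≤ i<j)
    where
    open IncreasingFlip F
    c = changed H ne

  flips⇒pointwise : ∀ {O O′ : AcyclicOrientation I} → TransClosure IncreasingFlip O O′ →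
                    ∀ H → headₐ O H ≤ headₐ O′ H
  flips⇒pointwise [ F ]    H = flip⇒pointwise F H
  flips⇒pointwise (F ∷ Fs) H = ≤-trans (flip⇒pointwise F H) (flips⇒pointwise Fs H)

  ≤ₒ-antisym : ∀ {O O′ : AcyclicOrientation I} → O ≤ₒ O′ → O′ ≤ₒ O → O ≈ₒ O′
  ≤ₒ-antisym (inj₁ e)  _          = e
  ≤ₒ-antisym (inj₂ _)  (inj₁ e)   = λ H → sym (e H)
  ≤ₒ-antisym (inj₂ Fs) (inj₂ Fs′) = λ H →
    ≤-antisym (flips⇒pointwise Fs H) (flips⇒pointwise Fs′ H)

hypergraphicPoset : IntervalHypergraph n → Poset 0ℓ 0ℓ 0ℓ
hypergraphicPoset I = record
  { Carrier = AcyclicOrientation I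
  ; _≈_ = _≈ₒ_
  ; _≤_ = _≤ₒ_
  ; isPartialOrder = record
    { isPreorder = record
      { isEquivalence = record
        { refl  = λ H → refl
        ; sym   = λ e H → sym (e H)
        ; trans = λ e e′ H → trans (e H) (e′ H)
        }
      ; reflexive = inj₁
      ; trans = ≤ₒ-trans
      }
    ; antisym = ≤ₒ-antisym
    }
  }

-- A permutation π has one-line notation (π ⟨$⟩ʳ 0) (π ⟨$⟩ʳ 1) …, so
-- π ⟨$⟩ˡ a is the position of the value a.  Inversions are pairs of values:
-- covers of the weak order exchange values in adjacent positions.

Inversion : Permutation′ n → Fin n → Fin n → Set
Inversion π a b = a < b × π ⟨$⟩ˡ b < π ⟨$⟩ˡ a

infix 4 _≤ᵂ_

_≤ᵂ_ : Rel (Permutation′ n) 0ℓ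
π ≤ᵂ ρ = ∀ a b → Inversion π a b → Inversion ρ a b

private
  increasing⇒inflationary : (f : Fin n → Fin n) → (∀ {i j} → i < j → f i < f j) →
                            ∀ i → i ≤ f i
  increasing⇒inflationary {n} f mono i = go (toℕ i) i refl
    where
    go : ∀ k (i : Fin n) → toℕ i ≡ k → k ℕ.≤ toℕ (f i)
    go ℕ.zero    i       e = ℕ.z≤n
    go (ℕ.suc k) (suc i) e = ℕ.≤-trans
      (ℕ.s≤s (go k (inject₁ i) (trans (toℕ-inject₁ i) (ℕ.suc-injective e))))
      (mono {inject₁ i} {suc i} (ℕ.≤-reflexive (cong ℕ.suc (toℕ-inject₁ i))))

  -- If π and ρ have the same inversions, then the position maps preserve
  -- each other's order.
  transport : (π ρ : Permutation′ n) → π ≤ᵂ ρ → ρ ≤ᵂ π →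
              ∀ {a b} → π ⟨$⟩ˡ a < π ⟨$⟩ˡ b → ρ ⟨$⟩ˡ a < ρ ⟨$⟩ˡ b
  transport π ρ π≤ρ ρ≤π {a} {b} lt with <-cmp a b
  ... | tri> _ _ b<a = proj₂ (π≤ρ b a (b<a , lt))
  ... | tri≈ _ refl _ = contradiction lt (<-irrefl refl)
  ... | tri< a<b _ _ with <-cmp (ρ ⟨$⟩ˡ a) (ρ ⟨$⟩ˡ b)
  ...   | tri< lt′ _ _ = lt′
  ...   | tri≈ _ e _ = contradiction a<b (<-irrefl
            (trans (sym (inverseʳ ρ)) (trans (cong (ρ ⟨$⟩ʳ_) e) (inverseʳ ρ))))
  ...   | tri> _ _ gt = contradiction (<-trans lt (proj₂ (ρ≤π a b (a<b , gt)))) (<-irrefl refl)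

  position-≤ : (π ρ : Permutation′ n) → π ≤ᵂ ρ → ρ ≤ᵂ π →
               ∀ a → π ⟨$⟩ˡ a ≤ ρ ⟨$⟩ˡ a
  position-≤ π ρ π≤ρ ρ≤π a = subst (λ b → π ⟨$⟩ˡ a ≤ ρ ⟨$⟩ˡ b) (inverseʳ π)
    (increasing⇒inflationary (λ i → ρ ⟨$⟩ˡ (π ⟨$⟩ʳ i))
      (λ i<j → transport π ρ π≤ρ ρ≤π
        (subst₂ _<_ (sym (inverseˡ π)) (sym (inverseˡ π)) i<j))
      (π ⟨$⟩ˡ a))

  ≤ᵂ-antisym : {π ρ : Permutation′ n} → π ≤ᵂ ρ → ρ ≤ᵂ π → π ≈ₚ ρ
  ≤ᵂ-antisym {π = π} {ρ} π≤ρ ρ≤π i =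
    trans (sym (inverseʳ ρ)) (cong (ρ ⟨$⟩ʳ_) (trans (sym same) (inverseˡ π)))
    where
    same : π ⟨$⟩ˡ (π ⟨$⟩ʳ i) ≡ ρ ⟨$⟩ˡ (π ⟨$⟩ʳ i)
    same = ≤-antisym (position-≤ π ρ π≤ρ ρ≤π _) (position-≤ ρ π ρ≤π π≤ρ _)

  ≈ₚ⇒positions : {π ρ : Permutation′ n} → π ≈ₚ ρ → ∀ a → π ⟨$⟩ˡ a ≡ ρ ⟨$⟩ˡ a
  ≈ₚ⇒positions {π = π} {ρ} e a =
    trans (sym (inverseˡ ρ)) (cong (ρ ⟨$⟩ˡ_) (trans (sym (e _)) (inverseʳ π)))

weakOrder : ℕ → Poset 0ℓ 0ℓ 0ℓ
weakOrder n = record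
  { Carrier = Permutation′ n
  ; _≈_ = _≈ₚ_
  ; _≤_ = _≤ᵂ_
  ; isPartialOrder = record
    { isPreorder = record
      { isEquivalence = record
        { refl  = λ _ → refl
        ; sym   = λ e i → sym (e i)
        ; trans = λ e e′ i → trans (e i) (e′ i)
        }
      ; reflexive = λ {π} {ρ} e a b (a<b , lt) →
          a<b , subst₂ _<_ (≈ₚ⇒positions {π = π} {ρ} e b) (≈ₚ⇒positions {π = π} {ρ} e a) lt
      ; trans = λ p q a b → q a b ∘ p a b
      }
    ; antisym = λ {π} {ρ} → ≤ᵂ-antisym {π = π} {ρ}
    }
  }

IsMinimum : Pred (Fin n) 0ℓ → Pred (Fin n) 0ℓ
IsMinimum P j = P j × (∀ k → P k → j ≤ k)

minimum : {P : Pred (Fin n) 0ℓ} → Decidable P → ∃ P → ∃ (IsMinimum P)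
minimum {ℕ.suc n} {P} P? (w , Pw) with P? zero
... | yes P0 = zero , P0 , λ _ _ → ℕ.z≤n
... | no ¬P0 with w
...   | zero  = contradiction Pw ¬P0
...   | suc v with minimum (P? ∘ suc) (v , Pw)
...     | j , Pj , least = suc j , Pj , λ where
            zero    P0 → contradiction P0 ¬P0
            (suc k) Pk → ℕ.s≤s (least k Pk)

firstPosition : (π : Permutation′ n) (H : Interval n) →
                ∃ (IsMinimum (λ j → π ⟨$⟩ʳ j ∈ H))
firstPosition π H = minimum (λ j → (π ⟨$⟩ʳ j) ∈? H)
  (π ⟨$⟩ˡ lo H , subst (_∈ H) (sym (inverseʳ π)) (lo∈ H))

module _ {n : ℕ} (I : IntervalHypergraph n) (π : Permutation′ n) where

  orientationOf : Orientation I
  orientationOf = record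
    { head  = λ H → π ⟨$⟩ʳ proj₁ (firstPosition π (edge H))
    ; head∈ = λ H → proj₁ (proj₂ (firstPosition π (edge H)))
    }

  private
    pos : Hyperedge I → Fin n
    pos H = proj₁ (firstPosition π (edge H))

    step-< : ∀ H H′ → head orientationOf H′ ∈ edge H ×
             head orientationOf H′ ≢ head orientationOf H → pos H < pos H′
    step-< H H′ (h′∈H , ne) = ℕ.≤∧≢⇒<
      (proj₂ (proj₂ (firstPosition π (edge H))) (pos H′) h′∈H)
      (λ e → ne (cong (π ⟨$⟩ʳ_) (sym (toℕ-injective e))))

    chain-≤ : ∀ m (f : Fin (ℕ.suc m) → Fin n) →
              (∀ i → f (inject₁ i) < f (suc i)) → f zero ≤ f (fromℕ m)
    chain-≤ ℕ.zero    f lt = ≤-refl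
    chain-≤ (ℕ.suc m) f lt =
      ≤-trans (ℕ.<⇒≤ (lt zero)) (chain-≤ m (f ∘ suc) (lt ∘ suc))

  orientationOf-acyclic : ¬ Cycle orientationOf
  orientationOf-acyclic C = ℕ.<-irrefl refl (ℕ.≤-<-trans
    (chain-≤ (1 ℕ.+ m) (pos ∘ H) (λ i → step-< (H (inject₁ i)) (H (suc i)) (step i)))
    (step-< (H (fromℕ (1 ℕ.+ m))) (H zero) return))
    where open Cycle C

  Or : AcyclicOrientation I
  Or = record { orientation = orientationOf ; acyclic = orientationOf-acyclic }

{-# OPTIONS --safe #-}
module Submission where

-- For an acyclic orientation O let c be forced before a whenever a < c lie in a
-- hyperedge H with O(H) = c.  Intervals are convex, so the transitive closure of
-- these forced inversions is biclosed; it is the inversion set of the least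
-- permutation in the fibre of Or over O.  If I is closed under initial
-- subintervals, forced inversions are monotone in O, so that Or has a monotone
-- left adjoint and preserves meets.  Conversely let [i,k] be in I but not [i,j].
-- Moving j in front of i in the identity gives π with Or_π([i,k]) = j, and π lies
-- below ρ′ = [< i] [> j] j i ]i,j[.  Exchanging the adjacent values i and j of ρ′
-- gives ρ in the same fibre, as [i,j] is not in I; preservation of meets would
-- give Or_(π∧ρ) = Or_π, although i precedes j in π ∧ ρ.

open import Data.Fin.Base as Fin using (Fin; zero; suc; toℕ; fromℕ<; opposite; combine; remQuot; punchOut; _<_)
open import Data.Fin.Permutation using (Permutation′; permutation; _⟨$⟩ʳ_; _⟨$⟩ˡ_; inverseˡ; inverseʳ)
  renaming (_≈_ to _≈ₚ_)
open import Data.Fin.Properties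
  using (any?; _≟_; _≤?_; _<?_; toℕ-injective; toℕ<n; toℕ-fromℕ<; <⇒notInjective; punchOut-injective;
         remQuot-combine; opposite-prop; opposite-involutive)
open import Data.Fin.Subset as Subset using (Subset; ∣_∣)
open import Data.Fin.Subset.Properties using (∈⊤; ∣⊤∣≡n; p⊂q⇒∣p∣<∣q∣)
open import Data.Nat.Base as ℕ using (ℕ; _≤_)
import Data.Nat.Properties as ℕ
open import Data.Nat.Induction using (<-wellFounded)
open import Data.Product.Base using (Σ; ∃; ∃₂; _×_; _,_; proj₁; proj₂; uncurry)
open import Data.Sum.Base using (_⊎_; inj₁; inj₂) renaming ([_,_] to either; map to map-⊎)
open import Data.Vec.Base using (tabulate)
open import Data.Vec.Properties using (lookup⇒[]=; []=⇒lookup; lookup∘tabulate)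
open import Function.Base using (_∘_; id; flip)
open import Function.Bundles using (_⇔_; mk⇔; Equivalence)
open import Function.Definitions using (Injective)
open import Induction.WellFounded using (Acc; acc)
open import Level using (0ℓ)
open import Relation.Binary.Bundles using (Poset)
open import Relation.Binary.Construct.Closure.Transitive using (TransClosure; [_]; _∷_; _++_)
open import Relation.Binary.Core using (Rel)
open import Relation.Binary.Definitions using (tri<; tri≈; tri>; Trichotomous) renaming (Decidable to Decidable₂)
open import Relation.Binary.Lattice.Definitions using (Infimum)
open import Relation.Binary.PropositionalEquality
  using (_≡_; _≢_; refl; sym; trans; cong; subst; subst₂; isEquivalence)
open import Relation.Binary.Properties.Poset using (≥-poset)
open import Relation.Binary.Structures using (IsStrictTotalOrder; IsPartialOrder)
open import Relation.Nullary using (¬_; Dec; yes; no; contradiction; does; proof; Reflects; invert)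
open import Relation.Nullary.Decidable using (dec-true; map′; _×-dec_; _⊎-dec_; ¬?; recompute; decidable-stable)
open import Relation.Unary using (Pred; Decidable)
open import Defs

private
  variable
    n : ℕ

-- Counting and permutations

subset : {P : Pred (Fin n) 0ℓ} → Decidable P → Subset n
subset P? = tabulate (does ∘ P?)

module _ {P : Pred (Fin n) 0ℓ} (P? : Decidable P) where

  ∈-subset⁺ : ∀ {x} → P x → x Subset.∈ subset P?
  ∈-subset⁺ {x} Px = lookup⇒[]= x _ (trans (lookup∘tabulate _ x) (dec-true (P? x) Px))

  ∈-subset⁻ : ∀ {x} → x Subset.∈ subset P? → P x
  ∈-subset⁻ {x} x∈ = invert (subst (Reflects (P x))
    (trans (sym (lookup∘tabulate _ x)) ([]=⇒lookup x∈)) (proof (P? x)))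

∣subset∣-mono-< : {P Q : Pred (Fin n) 0ℓ} (P? : Decidable P) (Q? : Decidable Q) →
                  (∀ {x} → P x → Q x) → (∃ λ x → Q x × ¬ P x) →
                  ∣ subset P? ∣ ℕ.< ∣ subset Q? ∣
∣subset∣-mono-< P? Q? P⊆Q (x , Qx , ¬Px) = p⊂q⇒∣p∣<∣q∣
  ( (λ x∈ → ∈-subset⁺ Q? (P⊆Q (∈-subset⁻ P? x∈)))
  , x , ∈-subset⁺ Q? Qx , λ x∈ → ¬Px (∈-subset⁻ P? x∈))

-- If `y` were missed, punching it out of the codomain would give an injection into a smaller finite
-- set.
injective⇒surjective : (f : Fin n → Fin n) → Injective _≡_ _≡_ f → ∀ y → ∃ λ x → f x ≡ y
injective⇒surjective {ℕ.suc n} f f-inj y with any? (λ x → f x ≟ y)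
... | yes hit = hit
... | no miss = contradiction
  (λ {i} {j} e → f-inj (punchOut-injective (avoid i) (avoid j) e))
  (<⇒notInjective {f = λ x → punchOut (avoid x)} (ℕ.n<1+n n))
  where
  avoid : ∀ x → y ≢ f x
  avoid x e = miss (x , sym e)

position-injective : (π : Permutation′ n) → ∀ {a b} → π ⟨$⟩ˡ a ≡ π ⟨$⟩ˡ b → a ≡ b
position-injective π e = trans (sym (inverseʳ π)) (trans (cong (π ⟨$⟩ʳ_) e) (inverseʳ π))

≢∧≮⇒> : (f : Fin n → Fin n) → (∀ {a b} → f a ≡ f b → a ≡ b) →
        ∀ {a b} → a ≢ b → ¬ f a < f b → f b < f a
≢∧≮⇒> f f-inj a≢b ≮ = ℕ.≤∧≢⇒< (ℕ.≮⇒≥ ≮) λ e → a≢b (f-inj (toℕ-injective (sym e)))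

module _ {_≺_ : Rel (Fin n) 0ℓ} (isSTO : IsStrictTotalOrder _≡_ _≺_) where
  private
    module ≺ = IsStrictTotalOrder isSTO

    below? : ∀ a → Decidable (_≺ a)
    below? a b = b ≺.<? a

    rank : Fin n → ℕ
    rank a = ∣ subset (below? a) ∣

    rank-mono : ∀ {a b} → a ≺ b → rank a ℕ.< rank b
    rank-mono {a} {b} a≺b = ∣subset∣-mono-< (below? a) (below? b)
      (λ x≺a → ≺.trans x≺a a≺b) (a , a≺b , ≺.irrefl refl)

    rank<n : ∀ a → rank a ℕ.< n
    rank<n a = subst (rank a ℕ.<_) (∣⊤∣≡n n) (p⊂q⇒∣p∣<∣q∣
      ((λ _ → ∈⊤) , a , ∈⊤ , λ a∈ → ≺.irrefl refl (∈-subset⁻ (below? a) a∈)))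

    place : Fin n → Fin n
    place a = fromℕ< (rank<n a)

    place-mono : ∀ {a b} → a ≺ b → place a < place b
    place-mono a≺b = subst₂ ℕ._<_ (sym (toℕ-fromℕ< _)) (sym (toℕ-fromℕ< _)) (rank-mono a≺b)

    place-injective : Injective _≡_ _≡_ place
    place-injective {a} {b} e with ≺.compare a b
    ... | tri< lt _ _ = contradiction (place-mono lt) (ℕ.<-irrefl (cong toℕ e))
    ... | tri≈ _ e′ _ = e′
    ... | tri> _ _ gt = contradiction (place-mono gt) (ℕ.<-irrefl (cong toℕ (sym e)))

    place⁻¹ : ∀ p → ∃ λ a → place a ≡ p
    place⁻¹ = injective⇒surjective place place-injective

  -- The number of predecessors is strictly increasing along `_≺_` and less than `n`, hence an
  -- injection of a finite set into itself. Its inverse is the one-line notation.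
  sorted : ∃ λ (π : Permutation′ n) → ∀ {a b} → a ≺ b → π ⟨$⟩ˡ a < π ⟨$⟩ˡ b
  sorted = permutation (proj₁ ∘ place⁻¹) place
             (λ a → place-injective (proj₂ (place⁻¹ (place a))))
             (λ p → proj₂ (place⁻¹ p))
         , place-mono

-- The weak order relative to a linear order on values

module ValueOrder (val : Fin n → Fin n) (val-injective : ∀ {a b} → val a ≡ val b → a ≡ b) where

  infix 4 _⊏_ _⊏?_

  _⊏_ : Rel (Fin n) 0ℓ
  a ⊏ b = val a < val b

  _⊏?_ : Decidable₂ _⊏_
  a ⊏? b = val a <? val b

  ⊏-cmp : Trichotomous _≡_ _⊏_
  ⊏-cmp a b with ℕ.<-cmp (toℕ (val a)) (toℕ (val b))
  ... | tri< lt ne ng = tri< lt (ne ∘ cong (toℕ ∘ val)) ng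
  ... | tri≈ nl e ng  = tri≈ nl (val-injective (toℕ-injective e)) ng
  ... | tri> nl ne gt = tri> nl (ne ∘ cong (toℕ ∘ val)) gt

  CoClosed : Rel (Fin n) 0ℓ → Set
  CoClosed R = ∀ {a b c} → a ⊏ b → b ⊏ c → R a c → R a b ⊎ R b c

  -- The classical axioms of inversion sets: the relation and its complement in `_⊏_` are both
  -- transitive, the latter put positively as a disjunction.
  record Biclosed (B : Rel (Fin n) 0ℓ) : Set where
    field
      B?       : Decidable₂ B
      B⊆⊏      : ∀ {a b} → B a b → a ⊏ b
      closed   : ∀ {a b c} → B a b → B b c → B a c
      coclosed : CoClosed B

  record HasInversions (π : Permutation′ n) (B : Rel (Fin n) 0ℓ) : Set where
    field
      inv⁺ : ∀ {a b} → B a b → π ⟨$⟩ˡ b < π ⟨$⟩ˡ a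
      inv⁻ : ∀ {a b} → a ⊏ b → π ⟨$⟩ˡ b < π ⟨$⟩ˡ a → B a b

    noninv⁺ : ∀ {a b} → a ⊏ b → ¬ B a b → π ⟨$⟩ˡ a < π ⟨$⟩ˡ b
    noninv⁺ a⊏b ¬B = ≢∧≮⇒> (π ⟨$⟩ˡ_) (position-injective π)
      (λ e → ℕ.<-irrefl (cong (toℕ ∘ val) (sym e)) a⊏b) (¬B ∘ inv⁻ a⊏b)

  open HasInversions public

  module _ {B : Rel (Fin n) 0ℓ} (biclosed : Biclosed B) where
    open Biclosed biclosed

    private
      infix 4 _≺_

      -- The order in which the values are to appear in the permutation: exactly the pairs in `B`
      -- are reversed.
      _≺_ : Rel (Fin n) 0ℓ
      a ≺ b = (a ⊏ b × ¬ B a b) ⊎ B b a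

      ≺-trans : ∀ {a b c} → a ≺ b → b ≺ c → a ≺ c
      ≺-trans (inj₁ (a⊏b , ¬ab)) (inj₁ (b⊏c , ¬bc)) =
        inj₁ (ℕ.<-trans a⊏b b⊏c , either ¬ab ¬bc ∘ coclosed a⊏b b⊏c)
      -- In the mixed cases the outer values are compared: `closed` excludes an unwanted inversion,
      -- `coclosed` supplies a needed one.
      ≺-trans {a} {b} {c} (inj₁ (a⊏b , ¬ab)) (inj₂ cb) with ⊏-cmp a c
      ... | tri< a⊏c _ _ = inj₁ (a⊏c , λ ac → ¬ab (closed ac cb))
      ... | tri≈ _ refl _ = contradiction cb ¬ab
      ... | tri> _ _ c⊏a = inj₂ (either id (flip contradiction ¬ab) (coclosed c⊏a a⊏b cb))
      ≺-trans {a} {b} {c} (inj₂ ba) (inj₁ (b⊏c , ¬bc)) with ⊏-cmp a c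
      ... | tri< a⊏c _ _ = inj₁ (a⊏c , λ ac → ¬bc (closed ba ac))
      ... | tri≈ _ refl _ = contradiction ba ¬bc
      ... | tri> _ _ c⊏a = inj₂ (either (flip contradiction ¬bc) id (coclosed b⊏c c⊏a ba))
      ≺-trans (inj₂ ba) (inj₂ cb) = inj₂ (closed cb ba)

      ≺-asym : ∀ {a b} → a ≺ b → ¬ b ≺ a
      ≺-asym (inj₁ (a⊏b , _))  (inj₁ (b⊏a , _)) = ℕ.<-asym a⊏b b⊏a
      ≺-asym (inj₁ (_ , ¬ab))  (inj₂ ab)        = ¬ab ab
      ≺-asym (inj₂ ba)         (inj₁ (_ , ¬ba)) = ¬ba ba
      ≺-asym (inj₂ ba)         (inj₂ ab)        = ℕ.<-asym (B⊆⊏ ba) (B⊆⊏ ab)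

      ≺-total : ∀ a b → a ≢ b → a ≺ b ⊎ b ≺ a
      ≺-total a b a≢b with ⊏-cmp a b | B? a b | B? b a
      ... | tri< _ _ _   | yes ab | _      = inj₂ (inj₂ ab)
      ... | tri< lt _ _  | no ¬ab | _      = inj₁ (inj₁ (lt , ¬ab))
      ... | tri≈ _ e _   | _      | _      = contradiction e a≢b
      ... | tri> _ _ _   | _      | yes ba = inj₁ (inj₂ ba)
      ... | tri> _ _ gt  | _      | no ¬ba = inj₂ (inj₁ (gt , ¬ba))

      ≺-cmp : Trichotomous _≡_ _≺_
      ≺-cmp a b with a ≟ b
      ... | yes refl = tri≈ (λ r → ≺-asym r r) refl (λ r → ≺-asym r r)
      ... | no a≢b with ≺-total a b a≢b
      ...   | inj₁ r = tri< r a≢b (≺-asym r)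
      ...   | inj₂ r = tri> (≺-asym r) a≢b r

      ≺-isStrictTotalOrder : IsStrictTotalOrder _≡_ _≺_
      ≺-isStrictTotalOrder = record
        { isStrictPartialOrder = record
          { isEquivalence = isEquivalence
          ; irrefl = λ { refl r → ≺-asym r r }
          ; trans = ≺-trans
          ; <-resp-≈ = (λ { refl → id }) , (λ { refl → id })
          }
        ; compare = ≺-cmp
        }

    abstract
      -- The values are listed along `_≺_`. The result is kept abstract, since nothing but its
      -- inversions is ever used.
      biclosed⇒permutation : ∃ λ π → HasInversions π B
      biclosed⇒permutation with sorted ≺-isStrictTotalOrder
      ... | π , ≺⇒< = π , record
        { inv⁺ = λ ab → ≺⇒< (inj₂ ab)
        ; inv⁻ = λ {a} {b} a⊏b lt → decidable-stable (B? a b)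
                   λ ¬ab → ℕ.<-asym lt (≺⇒< (inj₁ (a⊏b , ¬ab)))
        }

  module _ {R : Rel (Fin n) 0ℓ} (R⊆⊏ : ∀ {a b} → R a b → a ⊏ b) where

    TransClosure⊆⊏ : ∀ {a b} → TransClosure R a b → a ⊏ b
    TransClosure⊆⊏ [ r ]    = R⊆⊏ r
    TransClosure⊆⊏ (r ∷ rs) = ℕ.<-trans (R⊆⊏ r) (TransClosure⊆⊏ rs)

    -- A chain increases, so it either meets `b` or passes over it in one link. Coclosedness of `R`
    -- splits that link, and the piece obtained completes the chain up to `b` or the chain from `b`.
    TransClosure-coclosed : CoClosed R → CoClosed (TransClosure R)
    TransClosure-coclosed coc a⊏b b⊏c [ r ] with coc a⊏b b⊏c r
    ... | inj₁ r′ = inj₁ [ r′ ]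
    ... | inj₂ r′ = inj₂ [ r′ ]
    TransClosure-coclosed coc {a} {b} a⊏b b⊏c (_∷_ {y = x} r rs) with ⊏-cmp b x
    ... | tri≈ _ refl _ = inj₁ [ r ]
    ... | tri< b⊏x _ _ with coc a⊏b b⊏x r
    ...   | inj₁ r′ = inj₁ [ r′ ]
    ...   | inj₂ r′ = inj₂ (r′ ∷ rs)
    TransClosure-coclosed coc {a} {b} a⊏b b⊏c (_∷_ {y = x} r rs) | tri> _ _ x⊏b
      with TransClosure-coclosed coc x⊏b b⊏c rs
    ...   | inj₁ rs′ = inj₁ (r ∷ rs′)
    ...   | inj₂ rs′ = inj₂ rs′

    module _ (R? : Decidable₂ R) where
      private
        -- The fuel `k` bounds the distance from `val a` to `val c`. Every link raises `val`, so the
        -- bound drops with each link, and at zero no chain is possible.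
        decide : ∀ k a c → toℕ (val c) ℕ.≤ k ℕ.+ toℕ (val a) → Dec (TransClosure R a c)
        decide ℕ.zero    a c le = no λ rs → ℕ.<⇒≱ (TransClosure⊆⊏ rs) le
        decide (ℕ.suc k) a c le with R? a c
        ... | yes r = yes [ r ]
        ... | no ¬r = map′ (λ { (_ , r , rs) → r ∷ rs })
                           (λ { [ r ] → contradiction r ¬r ; (r ∷ rs) → _ , r , rs })
                           (any? via?)
          where
          via? : ∀ b → Dec (R a b × TransClosure R b c)
          via? b with R? a b
          ... | no ¬r′ = no (¬r′ ∘ proj₁)
          ... | yes r  = map′ (r ,_) proj₂ (decide k b c
            (ℕ.≤-trans le (ℕ.≤-trans (ℕ.≤-reflexive (sym (ℕ.+-suc k _))) (ℕ.+-monoʳ-≤ k (R⊆⊏ r)))))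

      TransClosure? : Decidable₂ (TransClosure R)
      TransClosure? a c = decide (toℕ (val c)) a c (ℕ.m≤m+n _ _)

      TransClosure-biclosed : CoClosed R → Biclosed (TransClosure R)
      TransClosure-biclosed coc = record
        { B? = TransClosure?
        ; B⊆⊏ = TransClosure⊆⊏
        ; closed = _++_
        ; coclosed = TransClosure-coclosed coc
        }

      -- Complementation in `_⊏_` exchanges closure and coclosure; the decision procedure for chains
      -- makes this constructive.
      TransClosure-complement-biclosed : CoClosed R → Biclosed (λ a b → a ⊏ b × ¬ TransClosure R a b)
      TransClosure-complement-biclosed coc = record
        { B? = λ a b → (a ⊏? b) ×-dec ¬? (TransClosure? a b)
        ; B⊆⊏ = proj₁
        ; closed = λ { (a⊏b , ¬ab) (b⊏c , ¬bc) → ℕ.<-trans a⊏b b⊏c ,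
                       either ¬ab ¬bc ∘ TransClosure-coclosed coc a⊏b b⊏c }
        ; coclosed = λ {a} {b} a⊏b b⊏c (_ , ¬ac) → complement a⊏b b⊏c ¬ac (TransClosure? a b)
        }
        where
        complement : ∀ {a b c} → a ⊏ b → b ⊏ c → ¬ TransClosure R a c → Dec (TransClosure R a b) →
                     (a ⊏ b × ¬ TransClosure R a b) ⊎ (b ⊏ c × ¬ TransClosure R b c)
        complement a⊏b b⊏c ¬ac (no ¬ab) = inj₁ (a⊏b , ¬ab)
        complement a⊏b b⊏c ¬ac (yes ab) = inj₂ (b⊏c , λ bc → ¬ac (ab ++ bc))

  -- Meets in the weak order

  infix 4 _≼_

  _≼_ : Rel (Permutation′ n) 0ℓ
  π ≼ ρ = ∀ {a b} → a ⊏ b → π ⟨$⟩ˡ b < π ⟨$⟩ˡ a → ρ ⟨$⟩ˡ b < ρ ⟨$⟩ˡ a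

  module _ (π ρ : Permutation′ n) where
    private
      Ascent : Rel (Fin n) 0ℓ
      Ascent a b = a ⊏ b × (π ⟨$⟩ˡ a < π ⟨$⟩ˡ b ⊎ ρ ⟨$⟩ˡ a < ρ ⟨$⟩ˡ b)

      Ascent? : Decidable₂ Ascent
      Ascent? a b = (a ⊏? b) ×-dec
        ((π ⟨$⟩ˡ a <? π ⟨$⟩ˡ b) ⊎-dec (ρ ⟨$⟩ˡ a <? ρ ⟨$⟩ˡ b))

      between : ∀ (σ : Permutation′ n) {a c} b → σ ⟨$⟩ˡ a < σ ⟨$⟩ˡ c →
                σ ⟨$⟩ˡ a < σ ⟨$⟩ˡ b ⊎ σ ⟨$⟩ˡ b < σ ⟨$⟩ˡ c
      between σ {a} b lt with σ ⟨$⟩ˡ a <? σ ⟨$⟩ˡ b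
      ... | yes lt′ = inj₁ lt′
      ... | no ≮    = inj₂ (ℕ.≤-<-trans (ℕ.≮⇒≥ ≮) lt)

      Ascent-coclosed : CoClosed Ascent
      Ascent-coclosed {b = b} a⊏b b⊏c (_ , inj₁ lt) with between π b lt
      ... | inj₁ l = inj₁ (a⊏b , inj₁ l)
      ... | inj₂ l = inj₂ (b⊏c , inj₁ l)
      Ascent-coclosed {b = b} a⊏b b⊏c (_ , inj₂ lt) with between ρ b lt
      ... | inj₁ l = inj₁ (a⊏b , inj₂ l)
      ... | inj₂ l = inj₂ (b⊏c , inj₂ l)

      -- The common inversions of two permutations need not be an inversion set. Closing the union
      -- of the ascents transitively and taking the complement gives the largest inversion set
      -- contained in both.
      meet : ∃ λ σ → HasInversions σ (λ a b → a ⊏ b × ¬ TransClosure Ascent a b)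
      meet = biclosed⇒permutation (TransClosure-complement-biclosed proj₁ Ascent? Ascent-coclosed)

      -- A lower bound has no inversion that `π` or `ρ` lacks, so it keeps the ascents of either.
      -- Chained, these weak inequalities still refute an inversion.
      Ascent⇒≤ : ∀ {σ} → σ ≼ π → σ ≼ ρ → ∀ {a b} → Ascent a b → σ ⟨$⟩ˡ a Fin.≤ σ ⟨$⟩ˡ b
      Ascent⇒≤ σ≼π σ≼ρ (a⊏b , inj₁ lt) = ℕ.≮⇒≥ λ gt → ℕ.<-asym lt (σ≼π a⊏b gt)
      Ascent⇒≤ σ≼π σ≼ρ (a⊏b , inj₂ lt) = ℕ.≮⇒≥ λ gt → ℕ.<-asym lt (σ≼ρ a⊏b gt)

      Ascents⇒≤ : ∀ {σ} → σ ≼ π → σ ≼ ρ → ∀ {a b} → TransClosure Ascent a b → σ ⟨$⟩ˡ a Fin.≤ σ ⟨$⟩ˡ b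
      Ascents⇒≤ {σ} σ≼π σ≼ρ [ r ]    = Ascent⇒≤ {σ} σ≼π σ≼ρ r
      Ascents⇒≤ {σ} σ≼π σ≼ρ (r ∷ rs) =
        ℕ.≤-trans (Ascent⇒≤ {σ} σ≼π σ≼ρ r) (Ascents⇒≤ {σ} σ≼π σ≼ρ rs)

    infimum : ∃ λ σ → (σ ≼ π) × (σ ≼ ρ) × (∀ τ → τ ≼ π → τ ≼ ρ → τ ≼ σ)
    infimum = proj₁ meet
      , (λ {a} {b} a⊏b gt → stable π a⊏b λ lt → proj₂ (inv⁻ σ-inv a⊏b gt) [ a⊏b , inj₁ lt ])
      , (λ {a} {b} a⊏b gt → stable ρ a⊏b λ lt → proj₂ (inv⁻ σ-inv a⊏b gt) [ a⊏b , inj₂ lt ])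
      , λ τ τ≼π τ≼ρ a⊏b gt → inv⁺ σ-inv (a⊏b , λ rs → ℕ.<⇒≱ gt (Ascents⇒≤ {τ} τ≼π τ≼ρ rs))
      where
      σ-inv = proj₂ meet

      stable : ∀ (τ : Permutation′ n) {a b} → a ⊏ b → ¬ τ ⟨$⟩ˡ a < τ ⟨$⟩ˡ b → τ ⟨$⟩ˡ b < τ ⟨$⟩ˡ a
      stable τ a⊏b = ≢∧≮⇒> (τ ⟨$⟩ˡ_) (position-injective τ)
        λ e → ℕ.<-irrefl (cong (toℕ ∘ val) e) a⊏b

-- Covers of the weak order and increasing flips

module NumericalOrder {n : ℕ} = ValueOrder {n} id id

module _ {I : IntervalHypergraph n} where

  -- The search runs over pairs of endpoints; the irrelevant proofs in a hyperedge are recovered by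
  -- decidability.
  any-hyperedge? : {P : Hyperedge I → Set} → Decidable P → Dec (∃ P)
  any-hyperedge? {P} P? = map′
    (λ { (l , h , _ , _ , p) → _ , p })
    (λ { (hyperedge (interval l h l≤h) m , p) →
         l , h , recompute (l ≤? h) l≤h , recompute (member? I (interval l h _)) m , p })
    (any? λ l → any? λ h → at l h)
    where
    at : ∀ l h → Dec (Σ (l Fin.≤ h) λ l≤h → Σ (Member I (interval l h l≤h)) λ m → P (hyperedge _ m))
    at l h with l ≤? h
    ... | no l≰h = no (l≰h ∘ proj₁)
    ... | yes l≤h with member? I (interval l h l≤h)
    ...   | no ¬m = no λ { (_ , m , _) → ¬m m }
    ...   | yes m = map′ (λ p → l≤h , m , p) (λ { (_ , _ , p) → p }) (P? (hyperedge _ m))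

  head-first : ∀ π (H : Hyperedge I) {x} → x ∈ edge H →
               π ⟨$⟩ˡ headₐ (Or I π) H Fin.≤ π ⟨$⟩ˡ x
  head-first π H x∈H = subst (Fin._≤ _) (sym (inverseˡ π))
    (proj₂ (proj₂ (firstPosition π (edge H))) _ (subst (_∈ edge H) (sym (inverseʳ π)) x∈H))

  head-unique : ∀ π (H : Hyperedge I) {h} → h ∈ edge H →
                (∀ {x} → x ∈ edge H → h ≢ x → π ⟨$⟩ˡ h < π ⟨$⟩ˡ x) → headₐ (Or I π) H ≡ h
  head-unique π H {h} h∈H first = sym (decidable-stable (h ≟ _) λ h≢ →
    ℕ.<⇒≱ (first (head∈ (orientationOf I π) H) h≢) (head-first π H h∈H))

  head-transfer : ∀ π ρ (H : Hyperedge I) →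
                  (∀ {x} → x ∈ edge H → π ⟨$⟩ˡ headₐ (Or I π) H < π ⟨$⟩ˡ x →
                           ρ ⟨$⟩ˡ headₐ (Or I π) H < ρ ⟨$⟩ˡ x) →
                  headₐ (Or I ρ) H ≡ headₐ (Or I π) H
  head-transfer π ρ H pres = head-unique ρ H (head∈ (orientationOf I π) H) λ x∈H h≢x →
    pres x∈H (ℕ.≤∧≢⇒< (head-first π H x∈H) (h≢x ∘ position-injective π ∘ toℕ-injective))

  -- Distinct heads would give a cycle of length `2 + m` with `m = 0`. Acyclicity enters the
  -- argument only through such cycles.
  no-2-cycle : (O : AcyclicOrientation I) (H H′ : Hyperedge I) →
               headₐ O H ∈ edge H′ → headₐ O H′ ∈ edge H → headₐ O H ≡ headₐ O H′
  no-2-cycle O H H′ h∈H′ h′∈H = decidable-stable (headₐ O H ≟ headₐ O H′) λ ne → acyclic O record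
    { m = 0
    ; H = λ { zero → H ; (suc zero) → H′ }
    ; step = λ { zero → h′∈H , ne ∘ sym }
    ; return = h∈H′ , ne
    }

  flip⇒≤ : {O O′ : AcyclicOrientation I} → IncreasingFlip O O′ → ∀ H → headₐ O H Fin.≤ headₐ O′ H
  flip⇒≤ {O} {O′} F H with headₐ O H ≟ headₐ O′ H
  ... | yes e = ℕ.≤-reflexive (cong toℕ e)
  ... | no ne with IncreasingFlip.changed F H ne
  ...   | e , e′ = subst₂ Fin._≤_ (sym e) (sym e′) (ℕ.<⇒≤ (IncreasingFlip.i<j F))

  ≤ₒ⇒≤ : {O O′ : AcyclicOrientation I} → O ≤ₒ O′ → ∀ H → headₐ O H Fin.≤ headₐ O′ H
  ≤ₒ⇒≤ (inj₁ e)        H = ℕ.≤-reflexive (cong toℕ (e H))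
  ≤ₒ⇒≤ (inj₂ [ F ])    H = flip⇒≤ F H
  ≤ₒ⇒≤ (inj₂ (F ∷ Fs)) H = ℕ.≤-trans (flip⇒≤ F H) (≤ₒ⇒≤ (inj₂ Fs) H)

  module Cover (π : Permutation′ n) {a b : Fin n} (a<b : a < b) (pa<pb : π ⟨$⟩ˡ a < π ⟨$⟩ˡ b)
               (adjacent : ∀ {y} → π ⟨$⟩ˡ y < π ⟨$⟩ˡ b → π ⟨$⟩ˡ y Fin.≤ π ⟨$⟩ˡ a) where
    open NumericalOrder

    Inv : Rel (Fin n) 0ℓ
    Inv x y = (x < y × π ⟨$⟩ˡ y < π ⟨$⟩ˡ x) ⊎ (x ≡ a × y ≡ b)

    adjacent-≢ : ∀ {y} → y ≢ a → π ⟨$⟩ˡ y < π ⟨$⟩ˡ b → π ⟨$⟩ˡ y < π ⟨$⟩ˡ a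
    adjacent-≢ y≢a lt = ℕ.≤∧≢⇒< (adjacent lt) (y≢a ∘ position-injective π ∘ toℕ-injective)

    -- As `a` and `b` are adjacent in `π`, any third value stands on the same side of both. Hence
    -- adding the single pair `(a, b)` to the inversions respects both closure conditions.
    Inv-closed : ∀ {x y z} → Inv x y → Inv y z → Inv x z
    Inv-closed (inj₁ (x<y , p)) (inj₁ (y<z , q)) = inj₁ (ℕ.<-trans x<y y<z , ℕ.<-trans q p)
    Inv-closed (inj₁ (x<a , p)) (inj₂ (refl , refl)) = inj₁ (ℕ.<-trans x<a a<b , ≢∧≮⇒> (π ⟨$⟩ˡ_)
      (position-injective π) (λ { refl → ℕ.<-asym x<a a<b }) λ q → ℕ.<⇒≱ p (adjacent q))
    Inv-closed (inj₂ (refl , refl)) (inj₁ (b<z , q)) = inj₁ (ℕ.<-trans a<b b<z ,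
      adjacent-≢ (λ { refl → ℕ.<-asym a<b b<z }) q)
    Inv-closed (inj₂ (refl , refl)) (inj₂ (refl , _)) = contradiction a<b (ℕ.<-irrefl refl)

    Inv-coclosed : CoClosed Inv
    Inv-coclosed {x} {y} {z} x<y y<z (inj₁ (_ , p)) with π ⟨$⟩ˡ z <? π ⟨$⟩ˡ y
    ... | yes q = inj₂ (inj₁ (y<z , q))
    ... | no ≮  = inj₁ (inj₁ (x<y , ℕ.≤-<-trans (ℕ.≮⇒≥ ≮) p))
    Inv-coclosed {_} {y} a<y y<b (inj₂ (refl , refl)) with π ⟨$⟩ˡ y <? π ⟨$⟩ˡ b
    ... | yes q = inj₁ (inj₁ (a<y , adjacent-≢ (λ { refl → ℕ.<-irrefl refl a<y }) q))
    ... | no ≮  = inj₂ (inj₁ (y<b , ≢∧≮⇒> (π ⟨$⟩ˡ_) (position-injective π)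
      (λ { refl → ℕ.<-irrefl refl y<b }) ≮))

    cover : ∃ λ π′ → HasInversions π′ Inv
    cover = biclosed⇒permutation record
      { B? = λ x y → ((x <? y) ×-dec (π ⟨$⟩ˡ y <? π ⟨$⟩ˡ x)) ⊎-dec ((x ≟ a) ×-dec (y ≟ b))
      ; B⊆⊏ = λ { (inj₁ (lt , _)) → lt ; (inj₂ (refl , refl)) → a<b }
      ; closed = Inv-closed
      ; coclosed = Inv-coclosed
      }

    π′ : Permutation′ n
    π′ = proj₁ cover

    π′-inv : HasInversions π′ Inv
    π′-inv = proj₂ cover

    exchanged : π′ ⟨$⟩ˡ b < π′ ⟨$⟩ˡ a
    exchanged = inv⁺ π′-inv (inj₂ (refl , refl))

    kept : ∀ {x y} → ¬ (x ≡ a × y ≡ b) → π ⟨$⟩ˡ x < π ⟨$⟩ˡ y → π′ ⟨$⟩ˡ x < π′ ⟨$⟩ˡ y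
    kept {x} {y} ≢ab lt with ⊏-cmp x y
    ... | tri< x<y _ _ = noninv⁺ π′-inv x<y λ { (inj₁ (_ , gt)) → ℕ.<-asym lt gt ; (inj₂ e) → ≢ab e }
    ... | tri≈ _ refl _ = contradiction lt (ℕ.<-irrefl refl)
    ... | tri> _ _ y<x = inv⁺ π′-inv (inj₁ (y<x , lt))

    head-exchanged : ∀ (H : Hyperedge I) → b ∈ edge H → headₐ (Or I π) H ≡ a → headₐ (Or I π′) H ≡ b
    head-exchanged H b∈H e = head-unique π′ H b∈H first
      where
      a-first : ∀ {x} → x ∈ edge H → π ⟨$⟩ˡ a Fin.≤ π ⟨$⟩ˡ x
      a-first x∈H = subst (λ h → π ⟨$⟩ˡ h Fin.≤ _) e (head-first π H x∈H)

      first : ∀ {x} → x ∈ edge H → b ≢ x → π′ ⟨$⟩ˡ b < π′ ⟨$⟩ˡ x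
      first {x} x∈H b≢x with x ≟ a
      ... | yes refl = exchanged
      ... | no x≢a = kept (λ { (refl , _) → ℕ.<-irrefl refl a<b })
        (≢∧≮⇒> (π ⟨$⟩ˡ_) (position-injective π) (b≢x ∘ sym)
          λ lt → ℕ.<⇒≱ (adjacent-≢ x≢a lt) (a-first x∈H))

    head-kept : ∀ (H : Hyperedge I) → ¬ (b ∈ edge H × headₐ (Or I π) H ≡ a) →
                headₐ (Or I π′) H ≡ headₐ (Or I π) H
    head-kept H ¬ab = head-transfer π π′ H λ x∈H → kept λ { (e , refl) → ¬ab (x∈H , e) }

    -- Only hyperedges that contain `b` and have head `a` are affected, and their head becomes `b`.
    -- So the exchange either changes nothing or is a single increasing flip.
    Or-cover : Or I π ≤ₒ Or I π′
    Or-cover with any-hyperedge? (λ H → (b ∈? edge H) ×-dec (headₐ (Or I π) H ≟ a))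
    ... | no none = inj₁ λ H → sym (head-kept H λ p → none (H , p))
    ... | yes (H₀ , b∈H₀ , e₀) = inj₂ [ record
      { distinct = λ e → ℕ.<-irrefl
          (cong toℕ (trans (sym e₀) (trans (e H₀) (head-exchanged H₀ b∈H₀ e₀)))) a<b
      ; i = a ; j = b ; i<j = a<b
      ; changed = changed
      ; flipped = λ H a∈H b∈H → mk⇔ (head-exchanged H b∈H) (back H a∈H)
      } ]
      where
      changed : ∀ H → headₐ (Or I π) H ≢ headₐ (Or I π′) H →
                headₐ (Or I π) H ≡ a × headₐ (Or I π′) H ≡ b
      changed H ne with (b ∈? edge H) ×-dec (headₐ (Or I π) H ≟ a)
      ... | yes (b∈H , e) = e , head-exchanged H b∈H e
      ... | no ¬ab = contradiction (sym (head-kept H ¬ab)) ne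

      back : ∀ H → a ∈ edge H → headₐ (Or I π′) H ≡ b → headₐ (Or I π) H ≡ a
      back H a∈H e′ with headₐ (Or I π) H ≟ a
      ... | yes e = e
      -- Here the head is not changed by the exchange, so `b` would come first in `H` under `π`,
      -- although `a` lies in `H` and precedes it.
      ... | no ne = contradiction pa<pb (ℕ.≤⇒≯ (subst (λ h → π ⟨$⟩ˡ h Fin.≤ _)
        (trans (sym (head-kept H (ne ∘ proj₂))) e′) (head-first π H a∈H)))

-- Monotonicity of `Or`

consecutive⇒increasing : (f : Fin n → Fin n) → (∀ {p q} → toℕ q ≡ ℕ.suc (toℕ p) → f p < f q) →
                         ∀ {p q} → p < q → f p < f q
consecutive⇒increasing {n} f step {p} {q} = go (toℕ q) q refl
  where
  go : ∀ k q → toℕ q ≡ k → p < q → f p < f q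
  go ℕ.zero    q e p<q = contradiction (subst (toℕ p ℕ.<_) e p<q) ℕ.n≮0
  go (ℕ.suc k) q e p<q with ℕ.m<1+n⇒m<n∨m≡n (subst (toℕ p ℕ.<_) e p<q)
  ... | inj₂ p≡k = step (trans e (cong ℕ.suc (sym p≡k)))
  ... | inj₁ p<k = ℕ.<-trans (go k r toℕr≡k (subst (toℕ p ℕ.<_) (sym toℕr≡k) p<k))
                             (step (trans e (cong ℕ.suc (sym toℕr≡k))))
    where
    k<n : k ℕ.< n
    k<n = ℕ.≤-trans (ℕ.n≤1+n _) (subst (ℕ._< n) e (toℕ<n q))

    r = fromℕ< k<n

    toℕr≡k = toℕ-fromℕ< k<n

module _ (I : IntervalHypergraph n) where

  private
    -- Pairs of values are coded in `Fin (n * n)` so that they can be counted. The count is the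
    -- termination measure for climbing from `π` to `ρ`, as each cover gains an inversion.
    NonInversion : Permutation′ n → Pred (Fin (n ℕ.* n)) 0ℓ
    NonInversion π t = ¬ uncurry (Inversion π) (remQuot n t)

    NonInversion? : ∀ π → Decidable (NonInversion π)
    NonInversion? π t = ¬? ((_ <? _) ×-dec (π ⟨$⟩ˡ _ <? π ⟨$⟩ˡ _))

    noninversions : Permutation′ n → ℕ
    noninversions π = ∣ subset (NonInversion? π) ∣

    CoveringStep : (π ρ : Permutation′ n) → Fin n → Fin n → Set
    CoveringStep π ρ p q = toℕ q ≡ ℕ.suc (toℕ p) × π ⟨$⟩ʳ p < π ⟨$⟩ʳ q ×
                   ρ ⟨$⟩ˡ (π ⟨$⟩ʳ q) < ρ ⟨$⟩ˡ (π ⟨$⟩ʳ p)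

    CoveringStep? : ∀ π ρ p q → Dec (CoveringStep π ρ p q)
    CoveringStep? π ρ p q = (toℕ q ℕ.≟ ℕ.suc (toℕ p)) ×-dec
                    ((_ <? _) ×-dec (_ <? _))

    -- Values at consecutive positions of `π` keep their order in `ρ`: a descent because `π ≤ᵂ ρ`,
    -- an ascent because it would otherwise be a covering step.
    no-CoveringStep : ∀ π ρ → π ≤ᵂ ρ → ¬ ∃₂ (CoveringStep π ρ) →
              ∀ {x y} → π ⟨$⟩ˡ x < π ⟨$⟩ˡ y → ρ ⟨$⟩ˡ x < ρ ⟨$⟩ˡ y
    no-CoveringStep π ρ π≤ρ none lt = subst₂ (λ u v → ρ ⟨$⟩ˡ u < ρ ⟨$⟩ˡ v) (inverseʳ π) (inverseʳ π)
      (consecutive⇒increasing (λ p → ρ ⟨$⟩ˡ (π ⟨$⟩ʳ p)) consecutive lt)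
      where
      consecutive : ∀ {p q} → toℕ q ≡ ℕ.suc (toℕ p) → ρ ⟨$⟩ˡ (π ⟨$⟩ʳ p) < ρ ⟨$⟩ˡ (π ⟨$⟩ʳ q)
      consecutive {p} {q} e with NumericalOrder.⊏-cmp (π ⟨$⟩ʳ p) (π ⟨$⟩ʳ q)
      ... | tri< lt′ ne _ = ≢∧≮⇒> (ρ ⟨$⟩ˡ_) (position-injective ρ) (ne ∘ sym)
                              λ gt → none (p , q , e , lt′ , gt)
      ... | tri≈ _ e′ _ = contradiction (cong (π ⟨$⟩ˡ_) e′) λ e″ →
        ℕ.1+n≢n (trans (sym e) (cong toℕ (trans (sym (inverseˡ π)) (trans (sym e″) (inverseˡ π)))))
      ... | tri> _ _ gt = proj₂ (π≤ρ _ _ (gt , subst₂ _<_ (sym (inverseˡ π)) (sym (inverseˡ π))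
                                                 (ℕ.≤-reflexive (sym e))))

    mono : ∀ π ρ → Acc ℕ._<_ (noninversions π) → π ≤ᵂ ρ → Or I π ≤ₒ Or I ρ
    mono π ρ (acc rec) π≤ρ with any? (λ p → any? (CoveringStep? π ρ p))
    ... | no none = inj₁ λ H → sym (head-transfer π ρ H λ _ → no-CoveringStep π ρ π≤ρ none)
    ... | yes (p , q , q≡1+p , a<b , gt) =
      Poset.trans (hypergraphicPoset I) {Or I π} {Or I C.π′} {Or I ρ}
        C.Or-cover (mono C.π′ ρ (rec fewer) π′≤ρ)
      where
      a = π ⟨$⟩ʳ p
      b = π ⟨$⟩ʳ q

      pb≡1+pa : toℕ (π ⟨$⟩ˡ b) ≡ ℕ.suc (toℕ (π ⟨$⟩ˡ a))
      pb≡1+pa = trans (cong toℕ (inverseˡ π)) (trans q≡1+p (cong (ℕ.suc ∘ toℕ) (sym (inverseˡ π))))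

      pa<pb : π ⟨$⟩ˡ a < π ⟨$⟩ˡ b
      pa<pb = ℕ.≤-reflexive (sym pb≡1+pa)

      module C = Cover {I = I} π a<b pa<pb (λ lt → ℕ.s≤s⁻¹ (subst (_ ℕ.<_) pb≡1+pa lt))
      open NumericalOrder

      fewer : noninversions C.π′ ℕ.< noninversions π
      fewer = ∣subset∣-mono-< (NonInversion? C.π′) (NonInversion? π)
        (λ {t} ¬inv′ (lt , inv) → ¬inv′ (lt , inv⁺ C.π′-inv (inj₁ (lt , inv))))
        ( combine a b
        , subst (¬_ ∘ uncurry (Inversion π)) (sym (remQuot-combine a b)) (λ (_ , pb<pa) → ℕ.<-asym pa<pb pb<pa)
        , λ ¬inv′ → subst (¬_ ∘ uncurry (Inversion C.π′)) (remQuot-combine a b) ¬inv′ (a<b , C.exchanged))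

      π′≤ρ : C.π′ ≤ᵂ ρ
      π′≤ρ x y (x<y , inv) with inv⁻ C.π′-inv x<y inv
      ... | inj₁ i = π≤ρ x y i
      ... | inj₂ (refl , refl) = x<y , gt

  Or-mono : ∀ π ρ → π ≤ᵂ ρ → Or I π ≤ₒ Or I ρ
  Or-mono π ρ = mono π ρ (<-wellFounded _)

-- Semilattice morphisms

module _ (P Q : Poset 0ℓ 0ℓ 0ℓ) where
  private
    module P = Poset P
    module Q = Poset Q

  -- A monotone map with a monotone section choosing the least element of each
  -- fibre is a right adjoint, hence preserves meets.
  least-section⇒meet-morphism :
    (f : P.Carrier → Q.Carrier) (s : Q.Carrier → P.Carrier) →
    (∀ {a b} → a P.≤ b → f a Q.≤ f b) → (∀ {x y} → x Q.≤ y → s x P.≤ s y) →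
    (∀ x → f (s x) Q.≈ x) → (∀ a → s (f a) P.≤ a) →
    (_∧_ : P.Carrier → P.Carrier → P.Carrier) → Infimum P._≤_ _∧_ →
    IsMeetSemilatticeMorphism P Q f
  least-section⇒meet-morphism f s f-mono s-mono fs sf _∧_ inf = record
    { _∧₁_ = _∧_
    ; infimum₁ = inf
    ; _∧₂_ = λ x y → f (s x ∧ s y)
    ; infimum₂ = λ x y → inf₂ x y
    ; f-cong = λ e → Q.antisym (f-mono (P.reflexive e)) (f-mono (P.reflexive (P.Eq.sym e)))
    ; ∧-homo = λ a b → let ≤a , ≤b , greatest = inf a b in Q.antisym
        (proj₂ (proj₂ (inf₂ (f a) (f b))) _ (f-mono ≤a) (f-mono ≤b))
        (let ≤sfa , ≤sfb , _ = inf (s (f a)) (s (f b)) in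
         f-mono (greatest _ (P.trans ≤sfa (sf a)) (P.trans ≤sfb (sf b))))
    }
    where
    inf₂ : Infimum Q._≤_ (λ x y → f (s x ∧ s y))
    inf₂ x y = let ≤sx , ≤sy , greatest = inf (s x) (s y) in
        Q.trans (f-mono ≤sx) (Q.reflexive (fs x))
      , Q.trans (f-mono ≤sy) (Q.reflexive (fs y))
      , λ z z≤x z≤y → Q.trans (Q.reflexive (Q.Eq.sym (fs z)))
                              (f-mono (greatest _ (s-mono z≤x) (s-mono z≤y)))

  -- This is the consequence of meet preservation that an obstruction violates. As `f a` lies below
  -- `f b′`, which equals `f b`, the meet of `a` and `b` is sent to `f a`.
  meet-morphism-lifts : {f : P.Carrier → Q.Carrier} → IsMeetSemilatticeMorphism P Q f →
    ∀ {a b b′} → a P.≤ b′ → f b Q.≈ f b′ → ∃ λ c → c P.≤ b × f c Q.≈ f a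
  meet-morphism-lifts {f} morphism {a} {b} {b′} a≤b′ fb≈fb′ =
      a ∧₁ b
    , proj₁ (proj₂ (infimum₁ a b))
    , Q.Eq.trans (∧-homo a b) (Q.antisym (proj₁ (infimum₂ (f a) (f b)))
        (proj₂ (proj₂ (infimum₂ (f a) (f b))) _ Q.refl (Q.trans fa≤fb′ (Q.reflexive (Q.Eq.sym fb≈fb′)))))
    where
    open IsMeetSemilatticeMorphism morphism

    a≈a∧b′ : a P.≈ a ∧₁ b′
    a≈a∧b′ = let ≤a , _ , greatest = infimum₁ a b′ in P.antisym (greatest a P.refl a≤b′) ≤a

    -- Monotonicity is not part of the definition of a morphism; it follows from preserving the meet
    -- of `a` and `b′`.
    fa≤fb′ : f a Q.≤ f b′
    fa≤fb′ = Q.trans (Q.reflexive (Q.Eq.trans (f-cong a≈a∧b′) (∧-homo a b′)))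
                     (proj₁ (proj₂ (infimum₂ (f a) (f b′))))

  join⇒dual-meet : {f : P.Carrier → Q.Carrier} → IsJoinSemilatticeMorphism P Q f →
                   IsMeetSemilatticeMorphism (≥-poset P) (≥-poset Q) f
  join⇒dual-meet morphism = record
    { _∧₁_ = _∨₁_ ; infimum₁ = supremum₁ ; _∧₂_ = _∨₂_ ; infimum₂ = supremum₂
    ; f-cong = f-cong ; ∧-homo = ∨-homo }
    where open IsJoinSemilatticeMorphism morphism

  dual-meet⇒join : {f : P.Carrier → Q.Carrier} →
                   IsMeetSemilatticeMorphism (≥-poset P) (≥-poset Q) f →
                   IsJoinSemilatticeMorphism P Q f
  dual-meet⇒join morphism = record
    { _∨₁_ = _∧₁_ ; supremum₁ = infimum₁ ; _∨₂_ = _∧₂_ ; supremum₂ = infimum₂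
    ; f-cong = f-cong ; ∨-homo = ∧-homo }
    where open IsMeetSemilatticeMorphism morphism

-- Join morphisms are the meet morphisms of the dual posets, and they are handled
-- by reversing the linear order on values as well.
module Criterion
  (val : Fin n → Fin n) (val-injective : ∀ {a b} → val a ≡ val b → a ≡ b)
  (convex : ∀ {a b c} (H : Interval n) → a ∈ H → c ∈ H → val a < val b → val b < val c → b ∈ H)
  (I : IntervalHypergraph n)
  {_≤P_ : Rel (Permutation′ n) 0ℓ} {_≤Q_ : Rel (AcyclicOrientation I) 0ℓ}
  (P-po : IsPartialOrder _≈ₚ_ _≤P_) (Q-po : IsPartialOrder _≈ₒ_ _≤Q_)
  (≤P⇔≼ : ∀ π ρ → π ≤P ρ ⇔ ValueOrder._≼_ val val-injective π ρ)
  (≤Q⇒≤ : ∀ O O′ → O ≤Q O′ → ∀ H → val (headₐ O H) Fin.≤ val (headₐ O′ H))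
  (Or-mono : ∀ π ρ → π ≤P ρ → Or I π ≤Q Or I ρ)
  where
  open ValueOrder val val-injective

  private
    P Q : Poset 0ℓ 0ℓ 0ℓ
    P = record { isPartialOrder = P-po }
    Q = record { isPartialOrder = Q-po }

    to : ∀ {π ρ} → π ≤P ρ → π ≼ ρ
    to {π} {ρ} = Equivalence.to (≤P⇔≼ π ρ)

    from : ∀ {π ρ} → π ≼ ρ → π ≤P ρ
    from {π} {ρ} = Equivalence.from (≤P⇔≼ π ρ)

    ⊏-irrefl : ∀ {a b} → a ≡ b → ¬ a ⊏ b
    ⊏-irrefl refl = ℕ.<-irrefl refl

  -- The form of closure under initial or final subintervals that refers only to `_⊏_`: `H` can be
  -- cut off above `c` while keeping `a`.
  Truncatable : Set
  Truncatable = ∀ (H : Hyperedge I) {a c} → a ∈ edge H → c ∈ edge H → a ⊏ c →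
    ∃ λ (H′ : Hyperedge I) → a ∈ edge H′ × c ∈ edge H′ ×
      (∀ {x} → x ∈ edge H′ → x ∈ edge H × val x Fin.≤ val c)

  -- A failure of closure in terms of `_⊏_`: `H` starts at `i` and continues to `j`, and `escape`
  -- expresses that the segment from `i` to `j` is not itself a hyperedge.
  record Obstruction : Set where
    field
      i j    : Fin n
      i⊏j    : i ⊏ j
      H      : Hyperedge I
      i∈H    : i ∈ edge H
      j∈H    : j ∈ edge H
      least  : ∀ {x} → x ∈ edge H → val i Fin.≤ val x
      escape : ∀ (E : Hyperedge I) → i ∈ edge E → j ∈ edge E →
               ∃ λ y → y ∈ edge E × (y ⊏ i ⊎ j ⊏ y)

  -- Least permutations in the fibres of `Or`

  module _ (O : AcyclicOrientation I) where

    Forced : Rel (Fin n) 0ℓ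
    Forced a c = a ⊏ c × ∃ λ H → a ∈ edge H × headₐ O H ≡ c

    Forced? : Decidable₂ Forced
    Forced? a c = (a ⊏? c) ×-dec any-hyperedge? λ H → (a ∈? edge H) ×-dec (headₐ O H ≟ c)

    -- The hyperedge that forces `c` before `a` contains `b` by convexity, so it forces `c` before
    -- `b` as well.
    Forced-coclosed : CoClosed Forced
    Forced-coclosed a⊏b b⊏c (_ , H , a∈H , refl) =
      inj₂ (b⊏c , H , convex (edge H) a∈H (head∈ (orientation O) H) a⊏b b⊏c , refl)

    leastExtension : ∃ λ π → HasInversions π (TransClosure Forced)
    leastExtension = biclosed⇒permutation (TransClosure-biclosed proj₁ Forced? Forced-coclosed)

    least : Permutation′ n
    least = proj₁ leastExtension

    ¬Forced-head : ∀ H {x} → x ∈ edge H → ¬ Forced (headₐ O H) x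
    ¬Forced-head H x∈H (h⊏x , H′ , h∈H′ , refl) = ⊏-irrefl (no-2-cycle O H H′ h∈H′ x∈H) h⊏x

    -- The first link of a chain from the head to `x` ends between them, hence in `H` by convexity;
    -- that link alone already gives a cycle.
    ¬Forced⁺-head : ∀ H {x} → x ∈ edge H → ¬ TransClosure Forced (headₐ O H) x
    ¬Forced⁺-head H x∈H [ r ]    = ¬Forced-head H x∈H r
    ¬Forced⁺-head H x∈H (r ∷ rs) = ¬Forced-head H
      (convex (edge H) (head∈ (orientation O) H) x∈H (proj₁ r) (TransClosure⊆⊏ proj₁ rs)) r

    -- Elements of `H` below its head are forced after it, and no chain of forced pairs puts an
    -- element above the head before it.
    Or-least : Or I least ≈ₒ O
    Or-least H = head-unique least H (head∈ (orientation O) H) first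
      where
      first : ∀ {x} → x ∈ edge H → headₐ O H ≢ x → least ⟨$⟩ˡ headₐ O H < least ⟨$⟩ˡ x
      first {x} x∈H h≢x with ⊏-cmp (headₐ O H) x
      ... | tri< h⊏x _ _ = noninv⁺ (proj₂ leastExtension) h⊏x (¬Forced⁺-head H x∈H)
      ... | tri≈ _ e _   = contradiction e h≢x
      ... | tri> _ _ x⊏h = inv⁺ (proj₂ leastExtension) [ x⊏h , H , x∈H , refl ]

  -- A forced pair is inverted in `π`, because the head of a hyperedge comes first among its
  -- elements; chains follow by transitivity of position.
  least-Or : ∀ π → least (Or I π) ≼ π
  least-Or π a⊏b inv = descend (inv⁻ (proj₂ (leastExtension (Or I π))) a⊏b inv)
    where
    descend₁ : ∀ {a c} → Forced (Or I π) a c → π ⟨$⟩ˡ c < π ⟨$⟩ˡ a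
    descend₁ (a⊏c , H , a∈H , refl) = ℕ.≤∧≢⇒< (head-first π H a∈H)
      λ e → ⊏-irrefl (sym (position-injective π (toℕ-injective e))) a⊏c

    descend : ∀ {a c} → TransClosure (Forced (Or I π)) a c → π ⟨$⟩ˡ c < π ⟨$⟩ˡ a
    descend [ r ]    = descend₁ r
    descend (r ∷ rs) = ℕ.<-trans (descend rs) (descend₁ r)

  -- If O(H) = c then O is c on the truncation of H at c; since c is the greatest
  -- element there, every O′ ≥ O is c on it as well.
  Forced-mono : Truncatable → ∀ {O O′} → O ≤Q O′ → ∀ {a c} → Forced O a c → Forced O′ a c
  Forced-mono truncate {O} {O′} O≤O′ (a⊏c , H , a∈H , refl)
    with truncate H a∈H (head∈ (orientation O) H) a⊏c
  ... | H′ , a∈H′ , c∈H′ , ⊆H = a⊏c , H′ , a∈H′ , val-injective (toℕ-injective (ℕ.≤-antisym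
    (proj₂ (⊆H (head∈ (orientation O′) H′)))
    (subst (λ c → val c Fin.≤ _)
      (sym (no-2-cycle O H H′ c∈H′ (proj₁ (⊆H (head∈ (orientation O) H′)))))
      (≤Q⇒≤ O O′ O≤O′ H′))))

  least-mono : Truncatable → ∀ {O O′} → O ≤Q O′ → least O ≼ least O′
  least-mono truncate {O} {O′} O≤O′ a⊏b inv =
    inv⁺ (proj₂ (leastExtension O′)) (forced (inv⁻ (proj₂ (leastExtension O)) a⊏b inv))
    where
    forced : ∀ {a c} → TransClosure (Forced O) a c → TransClosure (Forced O′) a c
    forced [ r ]    = [ Forced-mono truncate O≤O′ r ]
    forced (r ∷ rs) = Forced-mono truncate O≤O′ r ∷ forced rs

  truncatable⇒morphism : Truncatable → IsMeetSemilatticeMorphism P Q (Or I)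
  truncatable⇒morphism truncate = least-section⇒meet-morphism P Q (Or I) least (Or-mono _ _)
    (λ {O} {O′} O≤O′ → from {least O} {least O′} (least-mono truncate O≤O′)) Or-least
    (λ π → from {least (Or I π)} {π} (least-Or π))
    (λ π ρ → proj₁ (infimum π ρ))
    λ π ρ → let σ , ≼π , ≼ρ , greatest = infimum π ρ in
      from {σ} {π} ≼π , from {σ} {ρ} ≼ρ ,
      λ τ τ≤π τ≤ρ → from {τ} {σ} (greatest τ (to {τ} {π} τ≤π) (to {τ} {ρ} τ≤ρ))

  -- π, ρ′ and ρ are the permutations of the introduction, with values ordered by ⊏.
  module _ (obstruction : Obstruction) where
    open Obstruction obstruction

    private
      InvΠ InvΡ′ InvΡ : Rel (Fin n) 0ℓ
      InvΠ x y  = val i Fin.≤ val x × x ⊏ y × y ≡ j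
      InvΡ′ x y = x ⊏ y × val i Fin.≤ val x × val x Fin.≤ val j × val j Fin.≤ val y
      InvΡ x y  = InvΡ′ x y × ¬ (x ≡ i × y ≡ j)

      InvΡ′? : Decidable₂ InvΡ′
      InvΡ′? x y = (x ⊏? y) ×-dec ((val i ≤? val x) ×-dec ((val x ≤? val j) ×-dec (val j ≤? val y)))

      InvΡ′-closed : ∀ {x y z} → InvΡ′ x y → InvΡ′ y z → InvΡ′ x z
      InvΡ′-closed (x⊏y , i≤x , x≤j , _) (y⊏z , _ , _ , j≤z) = ℕ.<-trans x⊏y y⊏z , i≤x , x≤j , j≤z

      -- The added inequalities ensure that the part returned is never the pair `(i, j)`, so the
      -- same splitting serves `InvΡ`.
      InvΡ′-split : ∀ {x y z} → x ⊏ y → y ⊏ z → InvΡ′ x z →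
                    (InvΡ′ x y × j ⊏ y) ⊎ (InvΡ′ y z × i ⊏ y)
      InvΡ′-split {y = y} x⊏y y⊏z (_ , i≤x , x≤j , j≤z) with val y ≤? val j
      ... | yes y≤j = inj₂ ((y⊏z , ℕ.≤-trans i≤x (ℕ.<⇒≤ x⊏y) , y≤j , j≤z) , ℕ.≤-<-trans i≤x x⊏y)
      ... | no y≰j  = inj₁ ((x⊏y , i≤x , x≤j , ℕ.<⇒≤ (ℕ.≰⇒> y≰j)) , ℕ.≰⇒> y≰j)

      Π : ∃ λ π → HasInversions π InvΠ
      Π = biclosed⇒permutation record
        { B? = λ x y → (val i ≤? val x) ×-dec ((x ⊏? y) ×-dec (y ≟ j))
        ; B⊆⊏ = λ (_ , x⊏y , _) → x⊏y
        ; closed = λ { (i≤x , x⊏j , _) (_ , y⊏j , e) → i≤x , ℕ.<-trans x⊏j y⊏j , e }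
        ; coclosed = λ { x⊏y y⊏z (i≤x , _ , e) → inj₂ (ℕ.≤-trans i≤x (ℕ.<⇒≤ x⊏y) , y⊏z , e) }
        }

      Ρ′ : ∃ λ ρ′ → HasInversions ρ′ InvΡ′
      Ρ′ = biclosed⇒permutation record
        { B? = InvΡ′?
        ; B⊆⊏ = proj₁
        ; closed = InvΡ′-closed
        ; coclosed = λ x⊏y y⊏z xz → map-⊎ proj₁ proj₁ (InvΡ′-split x⊏y y⊏z xz)
        }

      Ρ : ∃ λ ρ → HasInversions ρ InvΡ
      Ρ = biclosed⇒permutation record
        { B? = λ x y → InvΡ′? x y ×-dec ¬? ((x ≟ i) ×-dec (y ≟ j))
        ; B⊆⊏ = proj₁ ∘ proj₁
        ; closed = λ { (xy@(_ , _ , _ , j≤y) , _) (yz@(y⊏z , _) , _) →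
            InvΡ′-closed xy yz , λ { (_ , refl) → ℕ.<⇒≱ y⊏z j≤y } }
        ; coclosed = λ x⊏y y⊏z (xz , _) → map-⊎
            (λ (xy , j⊏y) → xy , λ { (_ , refl) → ℕ.<-irrefl refl j⊏y })
            (λ (yz , i⊏y) → yz , λ { (refl , _) → ℕ.<-irrefl refl i⊏y })
            (InvΡ′-split x⊏y y⊏z xz)
        }

      π ρ′ ρ : Permutation′ n
      π  = proj₁ Π
      ρ′ = proj₁ Ρ′
      ρ  = proj₁ Ρ

      π≼ρ′ : π ≼ ρ′
      π≼ρ′ a⊏b inv with inv⁻ (proj₂ Π) a⊏b inv
      ... | i≤a , a⊏j , refl = inv⁺ (proj₂ Ρ′) (a⊏j , i≤a , ℕ.<⇒≤ a⊏j , ℕ.≤-refl)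

      head-π : headₐ (Or I π) H ≡ j
      head-π = head-unique π H j∈H first
        where
        first : ∀ {x} → x ∈ edge H → j ≢ x → π ⟨$⟩ˡ j < π ⟨$⟩ˡ x
        first {x} x∈H j≢x with ⊏-cmp j x
        ... | tri< j⊏x _ _ = noninv⁺ (proj₂ Π) j⊏x λ (_ , _ , x≡j) → j≢x (sym x≡j)
        ... | tri≈ _ e _   = contradiction e j≢x
        ... | tri> _ _ x⊏j = inv⁺ (proj₂ Π) (Obstruction.least obstruction x∈H , x⊏j , refl)

      ρ′⇒ρ : ∀ {x y} → ¬ (y ≡ i × x ≡ j) → ρ′ ⟨$⟩ˡ x < ρ′ ⟨$⟩ˡ y → ρ ⟨$⟩ˡ x < ρ ⟨$⟩ˡ y
      ρ′⇒ρ {x} {y} ≢ij lt with ⊏-cmp x y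
      ... | tri< x⊏y _ _  = noninv⁺ (proj₂ Ρ) x⊏y λ (xy , _) → ℕ.<-asym lt (inv⁺ (proj₂ Ρ′) xy)
      ... | tri≈ _ refl _ = contradiction lt (ℕ.<-irrefl refl)
      ... | tri> _ _ y⊏x  = inv⁺ (proj₂ Ρ) (inv⁻ (proj₂ Ρ′) y⊏x lt , ≢ij)

      outside-first : ∀ {y} → y ⊏ i ⊎ j ⊏ y → ρ′ ⟨$⟩ˡ y < ρ′ ⟨$⟩ˡ j
      outside-first (inj₁ y⊏i) = noninv⁺ (proj₂ Ρ′) (ℕ.<-trans y⊏i i⊏j)
        λ (_ , i≤y , _) → ℕ.<⇒≱ y⊏i i≤y
      outside-first (inj₂ j⊏y) = inv⁺ (proj₂ Ρ′) (j⊏y , ℕ.<⇒≤ i⊏j , ℕ.≤-refl , ℕ.<⇒≤ j⊏y)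

      -- The two permutations differ only in the order of `i` and `j`. This could matter only for a
      -- hyperedge containing both with head `j`, and by `escape` such a hyperedge has an element
      -- that `ρ′` places before `j`.
      Or-ρ : Or I ρ ≈ₒ Or I ρ′
      Or-ρ E = head-transfer ρ′ ρ E λ x∈E → ρ′⇒ρ λ { (refl , h≡j) → j-not-first x∈E h≡j }
        where
        j-not-first : i ∈ edge E → headₐ (Or I ρ′) E ≢ j
        j-not-first i∈E h≡j with escape E i∈E (subst (_∈ edge E) h≡j (head∈ (orientationOf I ρ′) E))
        ... | y , y∈E , y-outside = ℕ.<⇒≱ (outside-first y-outside)
          (subst (λ h → ρ′ ⟨$⟩ˡ h Fin.≤ _) h≡j (head-first ρ′ E y∈E))

    -- Lifting along `Or-ρ` gives `σ` below `ρ` in the fibre of `π`. Then `σ` also gives `H` the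
    -- head `j`, so it inverts `i` and `j`, which `ρ` does not.
    obstruction⇒¬morphism : ¬ IsMeetSemilatticeMorphism P Q (Or I)
    obstruction⇒¬morphism morphism
      with meet-morphism-lifts P Q morphism {π} {ρ} {ρ′} (from {π} {ρ′} π≼ρ′) Or-ρ
    ... | σ , σ≤ρ , Or-σ = proj₂ (inv⁻ (proj₂ Ρ) i⊏j (to {σ} {ρ} σ≤ρ i⊏j j-before-i)) (refl , refl)
      where
      j-before-i : σ ⟨$⟩ˡ j < σ ⟨$⟩ˡ i
      j-before-i = ℕ.≤∧≢⇒<
        (subst (λ h → σ ⟨$⟩ˡ h Fin.≤ _) (trans (Or-σ H) head-π) (head-first σ H i∈H))
        λ e → ⊏-irrefl (sym (position-injective σ (toℕ-injective e))) i⊏j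

-- The numerical order and its reverse

module _ (I : IntervalHypergraph n) where

  private
    convex : ∀ {a b c} (H : Interval n) → a ∈ H → c ∈ H → a < b → b < c → b ∈ H
    convex _ (lo≤a , _) (_ , c≤hi) a<b b<c = ℕ.≤-trans lo≤a (ℕ.<⇒≤ a<b) , ℕ.≤-trans (ℕ.<⇒≤ b<c) c≤hi

    ≤ᵂ⇔≼ : (π ρ : Permutation′ n) → π ≤ᵂ ρ ⇔ ValueOrder._≼_ id id π ρ
    ≤ᵂ⇔≼ π ρ = mk⇔ (λ π≤ρ {a} {b} a<b inv → proj₂ (π≤ρ a b (a<b , inv)))
                   (λ π≼ρ _ _ (a<b , inv) → a<b , π≼ρ a<b inv)

    module InitialCriterion = Criterion id id convex I
      (Poset.isPartialOrder (weakOrder n)) (Poset.isPartialOrder (hypergraphicPoset I))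
      ≤ᵂ⇔≼ (λ O O′ → ≤ₒ⇒≤) (Or-mono I)

    opposite-injective : ∀ {a b : Fin n} → opposite a ≡ opposite b → a ≡ b
    opposite-injective e = trans (sym (opposite-involutive _)) (trans (cong opposite e) (opposite-involutive _))

    opposite-≤ : ∀ {a b : Fin n} → a Fin.≤ b → opposite b Fin.≤ opposite a
    opposite-≤ a≤b = subst₂ ℕ._≤_ (sym (opposite-prop _)) (sym (opposite-prop _)) (ℕ.∸-monoʳ-≤ n (ℕ.s≤s a≤b))

    opposite-<⁻ : ∀ {a b : Fin n} → opposite a < opposite b → b < a
    opposite-<⁻ lt = ℕ.≰⇒> λ a≤b → ℕ.<⇒≱ lt (opposite-≤ a≤b)

    opposite-< : ∀ {a b : Fin n} → a < b → opposite b < opposite a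
    opposite-< lt = opposite-<⁻ (subst₂ _<_ (sym (opposite-involutive _)) (sym (opposite-involutive _)) lt)

    descent-reversal : ∀ (π ρ : Permutation′ n) {a b : Fin n} → a ≢ b →
                       (ρ ⟨$⟩ˡ a < ρ ⟨$⟩ˡ b → π ⟨$⟩ˡ a < π ⟨$⟩ˡ b) →
                       π ⟨$⟩ˡ b < π ⟨$⟩ˡ a → ρ ⟨$⟩ˡ b < ρ ⟨$⟩ˡ a
    descent-reversal π ρ a≢b imp inv = ≢∧≮⇒> (ρ ⟨$⟩ˡ_) (position-injective ρ) a≢b
      λ lt → ℕ.<-asym inv (imp lt)

    -- With values reversed, `_≼_` compares noninversions, and containment of noninversions is the
    -- opposite containment of inversions.
    ≥ᵂ⇔≼ : (π ρ : Permutation′ n) → ρ ≤ᵂ π ⇔ ValueOrder._≼_ opposite opposite-injective π ρ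
    ≥ᵂ⇔≼ π ρ = mk⇔
      (λ ρ≤π {a} {b} a⊏b → descent-reversal π ρ (λ { refl → ℕ.<-irrefl refl a⊏b })
        λ lt → proj₂ (ρ≤π _ _ (opposite-<⁻ a⊏b , lt)))
      (λ π≼ρ _ _ (a<b , inv) → a<b , descent-reversal ρ π (λ { refl → ℕ.<-irrefl refl a<b })
        (π≼ρ (opposite-< a<b)) inv)

    module FinalCriterion = Criterion opposite opposite-injective
      (λ H a∈H c∈H b<a c<b → convex H c∈H a∈H (opposite-<⁻ c<b) (opposite-<⁻ b<a)) I
      (Poset.isPartialOrder (≥-poset (weakOrder n)))
      (Poset.isPartialOrder (≥-poset (hypergraphicPoset I)))
      ≥ᵂ⇔≼ (λ O O′ O′≤O H → opposite-≤ (≤ₒ⇒≤ O′≤O H)) (flip (Or-mono I))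

  hi∈ : (H : Interval n) → hi H ∈ H
  hi∈ (interval l h l≤h) = recompute (l ≤? h) l≤h , ℕ.≤-refl

  -- A hyperedge reaching beyond neither `i` nor `j` has these as endpoints, and an interval is
  -- determined by its endpoints.
  exceeds : ∀ {i j} (i<j : i < j) → ¬ Member I (interval i j (ℕ.<⇒≤ i<j)) →
            (E : Hyperedge I) → i ∈ edge E → j ∈ edge E → lo (edge E) < i ⊎ j < hi (edge E)
  exceeds {i} {j} i<j ¬m (hyperedge (interval l h _) m) (l≤i , _) (_ , j≤h) with l <? i | j <? h
  ... | yes l<i | _       = inj₁ l<i
  ... | no _    | yes j<h = inj₂ j<h
  ... | no l≮i  | no j≮h
    with toℕ-injective (ℕ.≤-antisym l≤i (ℕ.≮⇒≥ l≮i)) | toℕ-injective (ℕ.≤-antisym j≤h (ℕ.≮⇒≥ j≮h))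
  ...   | refl | refl = contradiction (recompute (member? I _) m) ¬m

  initial⇒truncatable : ClosedUnderInitial I → InitialCriterion.Truncatable
  initial⇒truncatable closed H@(hyperedge (interval l h _) m) {a} {c} a∈H c∈H a<c with c ≟ h
  -- Closure concerns proper subintervals only; a hyperedge that already ends at `c` is its own
  -- truncation.
  ... | yes refl = H , a∈H , c∈H , λ x∈H → x∈H , proj₂ x∈H
  ... | no c≢h = hyperedge (interval l c _) (closed l<c c<h (recompute (member? I _) m))
    , (proj₁ a∈H , ℕ.<⇒≤ a<c) , (proj₁ c∈H , ℕ.≤-refl)
    , λ (l≤x , x≤c) → (l≤x , ℕ.≤-trans x≤c (proj₂ c∈H)) , x≤c
    where
    l<c = ℕ.≤-<-trans (proj₁ a∈H) a<c
    c<h = ℕ.≤∧≢⇒< (proj₂ c∈H) (c≢h ∘ toℕ-injective)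

  unobstructed⇒initial : ¬ InitialCriterion.Obstruction → ClosedUnderInitial I
  unobstructed⇒initial unobstructed {i} {j} {k} i<j j<k m = decidable-stable (member? I _) λ ¬m →
    unobstructed record
      { i = i ; j = j ; i⊏j = i<j
      ; H = hyperedge _ m
      ; i∈H = ℕ.≤-refl , ℕ.<⇒≤ (ℕ.<-trans i<j j<k)
      ; j∈H = ℕ.<⇒≤ i<j , ℕ.<⇒≤ j<k
      ; least = proj₁
      ; escape = λ E i∈E j∈E → either (λ lo<i → _ , lo∈ (edge E) , inj₁ lo<i)
                                      (λ j<hi → _ , hi∈ (edge E) , inj₂ j<hi)
                                      (exceeds i<j ¬m E i∈E j∈E)
      }

  final⇒truncatable : ClosedUnderFinal I → FinalCriterion.Truncatable
  final⇒truncatable closed H@(hyperedge (interval l h _) m) {a} {c} a∈H c∈H a⊏c with l ≟ c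
  ... | yes refl = H , a∈H , c∈H , λ x∈H → x∈H , opposite-≤ (proj₁ x∈H)
  ... | no l≢c = hyperedge (interval c h _) (closed l<c c<h (recompute (member? I _) m))
    , (ℕ.<⇒≤ (opposite-<⁻ a⊏c) , proj₂ a∈H) , (ℕ.≤-refl , proj₂ c∈H)
    , λ (c≤x , x≤h) → (ℕ.≤-trans (proj₁ c∈H) c≤x , x≤h) , opposite-≤ c≤x
    where
    l<c = ℕ.≤∧≢⇒< (proj₁ c∈H) (l≢c ∘ toℕ-injective)
    c<h = ℕ.<-≤-trans (opposite-<⁻ a⊏c) (proj₂ a∈H)

  unobstructed⇒final : ¬ FinalCriterion.Obstruction → ClosedUnderFinal I
  unobstructed⇒final unobstructed {i} {j} {k} i<j j<k m = decidable-stable (member? I _) λ ¬m →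
    unobstructed record
      -- In the reversed order the least element of the interval is its upper endpoint `k`, and the
      -- missing segment runs from `j` to `k`.
      { i = k ; j = j ; i⊏j = opposite-< j<k
      ; H = hyperedge _ m
      ; i∈H = ℕ.<⇒≤ (ℕ.<-trans i<j j<k) , ℕ.≤-refl
      ; j∈H = ℕ.<⇒≤ i<j , ℕ.<⇒≤ j<k
      ; least = opposite-≤ ∘ proj₂
      ; escape = λ E k∈E j∈E → either (λ lo<j → _ , lo∈ (edge E) , inj₂ (opposite-< lo<j))
                                      (λ k<hi → _ , hi∈ (edge E) , inj₁ (opposite-< k<hi))
                                      (exceeds j<k ¬m E j∈E k∈E)
      }

  meet-morphism⇔initial :
    IsMeetSemilatticeMorphism (weakOrder n) (hypergraphicPoset I) (Or I) ⇔ ClosedUnderInitial I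
  meet-morphism⇔initial = mk⇔
    (λ morphism {i} {j} {k} → unobstructed⇒initial
      (λ ob → InitialCriterion.obstruction⇒¬morphism ob morphism) {i} {j} {k})
    (λ closed → InitialCriterion.truncatable⇒morphism
      (initial⇒truncatable λ {i} {j} {k} → closed {i} {j} {k}))

  join-morphism⇔final :
    IsJoinSemilatticeMorphism (weakOrder n) (hypergraphicPoset I) (Or I) ⇔ ClosedUnderFinal I
  join-morphism⇔final = mk⇔
    (λ morphism {i} {j} {k} → unobstructed⇒final
      (λ ob → FinalCriterion.obstruction⇒¬morphism ob
        (join⇒dual-meet (weakOrder n) (hypergraphicPoset I) morphism)) {i} {j} {k})
    (λ closed → dual-meet⇒join (weakOrder n) (hypergraphicPoset I)
      (FinalCriterion.truncatable⇒morphism (final⇒truncatable λ {i} {j} {k} → closed {i} {j} {k})))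

theoremD : ∀ (n : ℕ) → 1 ≤ n → (I : IntervalHypergraph n) →
    (IsMeetSemilatticeMorphism (weakOrder n) (hypergraphicPoset I) (Or I) ⇔ ClosedUnderInitial I)
    × (IsJoinSemilatticeMorphism (weakOrder n) (hypergraphicPoset I) (Or I) ⇔ ClosedUnderFinal I)
theoremD n _ I = meet-morphism⇔initial I , join-morphism⇔final I
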